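{- Let $\mathcal{F}$ be an $n$-periodic tame frieze with quiddity sequence $q$ of length $n$ ($n\ge1$, not necessarily the minimal period), let $\mathcal{L}=(m_{i,j})_{i,j\in\mathbb{Z}}$ be its lattice, and put $s_q:=m_{1,n}-m_{2,n-1}$. Then for all $i,j\in\mathbb{Z}$: (i) $m_{i,j+2n}=s_q\,m_{i,j+n}-m_{i,j}$; (ii) $m_{i-2n,j}=s_q\,m_{i-n,j}-m_{i,j}$.
   Context: A frieze is an array $\mathcal{F}=(m_{i,j})$ of real numbers, with $i\in\mathbb{Z}$, whose rows are the sets of positions with $j-i$ constant, such that $m_{i,i-2}=0$ and $m_{i,i-1}=1$ for all $i$, and such that $m_{i,j}m_{i+1,j+1}-m_{i,j+1}m_{i+1,j}=1$ whenever all four entries lie in the array. It is infinite if it is indexed by all $(i,j)$ with $j-i\ge -2$; it is finite if it is indexed by all $(i,j)$ with $-2\le j-i\le N-2$ for some integer $N\ge 3$ and ends with a row of ones followed by a row of zeros: $m_{i,i+N-3}=1$ and $m_{i,i+N-2}=0$ for all $i$. The quiddity row is $(a_i)_{i\in\mathbb{Z}}$ with $a_i=m_{i,i}$. The frieze is tame if every $3\times 3$ matrix $\begin{pmatrix} m_{i,j}&m_{i+1,j}&m_{i+2,j}\\ m_{i,j+1}&m_{i+1,j+1}&m_{i+2,j+1}\\ m_{i,j+2}&m_{i+1,j+2}&m_{i+2,j+2}\end{pmatrix}$ of entries of the array has determinant $0$. It is $n$-periodic if $m_{i+n,j+n}=m_{i,j}$ for all entries; then $q=(a_1,\dots,a_n)$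 is a quiddity sequence of length $n$ for $\mathcal{F}$. The lattice $\mathcal{L}=(m_{i,j})_{i,j\in\mathbb{Z}}$ of $\mathcal{F}$ is the extension of $\mathcal{F}$ to all of $\mathbb{Z}^2$ by anti-symmetric mirroring across rows of zeros: if $\mathcal{F}$ is infinite, $m_{i,j}=-m_{j+2,i-2}$ for $j-i<-2$; if $\mathcal{F}$ is finite, $\mathcal{L}$ is the unique extension satisfying $m_{i,j}=-m_{j+2,i-2}$ and $m_{i,j}=-m_{j-N+2,i+N-2}$ for all $i,j\in\mathbb{Z}$. -}

module Defs where

open import Algebra.Bundles using (CommutativeRing)
open import Data.Fin.Base as Fin using (Fin)
open import Data.Integer.Base using (ℤ; +_)
open import Data.Nat.Base as ℕ using (ℕ)
import Data.Nat.Properties as ℕₚ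
open import Data.Product.Base using (∃; _×_; _,_; proj₁; proj₂)
open import Data.Rational.Base as ℚ using (ℚ; 0ℚ; 1ℚ; ½; ∣_∣; positive)
import Data.Rational.Properties as ℚₚ
open import Data.Rational.Solver using (module +-*-Solver)
open import Data.Unit.Base using (⊤)
open import Data.Vec.Functional using (Vector)
open import Level using (Level; 0ℓ; _⊔_)
open import Relation.Binary.PropositionalEquality
  using (_≡_; refl; sym; trans; cong; subst)

-- The real numbers: Cauchy sequences of rationals, with equality meaning that
-- the difference tends to 0.  The ring operations are termwise.

module Reals where

  open import Data.Rational.Base using (_+_; _*_; _-_; -_; _<_; _≤_)

  Cauchy : (ℕ → ℚ) → Set
  Cauchy x = ∀ ε → 0ℚ < ε →
    ∃ λ N → ∀ m n → N ℕ.≤ m → N ℕ.≤ n → ∣ x m - x n ∣ < ε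

  record ℝ : Set where
    constructor mkℝ
    field
      seq    : ℕ → ℚ
      cauchy : Cauchy seq

  open ℝ public

  infix 4 _≈ʳ_

  record _≈ʳ_ (x y : ℝ) : Set where
    constructor mk≈
    field
      close : ∀ ε → 0ℚ < ε → ∃ λ N → ∀ n → N ℕ.≤ n → ∣ seq x n - seq y n ∣ < ε

  open _≈ʳ_ public

  private
    open ℚₚ.≤-Reasoning
    open +-*-Solver using (solve; _:+_; _:*_; _:-_; :-_; _:=_)

    -- opaque and abstract because unfolding these proofs makes type checking
    -- intractable
    opaque
      half-pos : ∀ {ε} → 0ℚ < ε → 0ℚ < ½ * ε
      half-pos {ε} 0<ε =
        ℚₚ.positive⁻¹ (½ * ε) {{ℚₚ.pos*pos⇒pos ½ ε {{positive 0<ε}}}}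

      half+half : ∀ ε → ½ * ε + ½ * ε ≡ ε
      half+half ε = trans (sym (ℚₚ.*-distribʳ-+ ε ½ ½)) (ℚₚ.*-identityˡ ε)

      sum< : ∀ {ε} p q → ∣ p ∣ < ½ * ε → ∣ q ∣ < ½ * ε → ∣ p + q ∣ < ε
      sum< {ε} p q p< q< = begin-strict
        ∣ p + q ∣      ≤⟨ ℚₚ.∣p+q∣≤∣p∣+∣q∣ p q ⟩
        ∣ p ∣ + ∣ q ∣  <⟨ ℚₚ.+-mono-< p< q< ⟩
        ½ * ε + ½ * ε  ≡⟨ half+half ε ⟩
        ε              ∎

      prod< : ∀ {B δ} p q → 0ℚ < B → ∣ p ∣ < B → ∣ q ∣ < δ → ∣ p * q ∣ < B * δ
      prod< {B} {δ} p q 0<B p< q< = begin-strict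
        ∣ p * q ∣      ≡⟨ ℚₚ.∣p*q∣≡∣p∣*∣q∣ p q ⟩
        ∣ p ∣ * ∣ q ∣  ≤⟨ ℚₚ.*-monoʳ-≤-nonNeg ∣ q ∣ {{ℚ.nonNegative (ℚₚ.0≤∣p∣ q)}} (ℚₚ.<⇒≤ p<) ⟩
        B * ∣ q ∣      <⟨ ℚₚ.*-monoʳ-<-pos B {{positive 0<B}} q< ⟩
        B * δ          ∎

      +-near : ∀ {ε} x x′ y y′ → ∣ x - x′ ∣ < ½ * ε → ∣ y - y′ ∣ < ½ * ε →
               ∣ (x + y) - (x′ + y′) ∣ < ε
      +-near {ε} x x′ y y′ p q = subst (λ z → ∣ z ∣ < ε)
        (solve 4 (λ x x′ y y′ → (x :- x′) :+ (y :- y′) := (x :+ y) :- (x′ :+ y′)) refl x x′ y y′)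
        (sum< (x - x′) (y - y′) p q)

      neg-near : ∀ {ε} x x′ → ∣ x - x′ ∣ < ε → ∣ (- x) - (- x′) ∣ < ε
      neg-near {ε} x x′ p = subst (_< ε)
        (trans (sym (ℚₚ.∣-p∣≡∣p∣ (x - x′)))
               (cong ∣_∣ (ℚₚ.neg-distrib-+ x (- x′)))) p

      swap-near : ∀ {ε} x y → ∣ x - y ∣ < ε → ∣ y - x ∣ < ε
      swap-near {ε} x y p = subst (_< ε)
        (trans (sym (ℚₚ.∣-p∣≡∣p∣ (x - y)))
               (cong ∣_∣ (solve 2 (λ x y → :- (x :- y) := y :- x) refl x y))) p

      trans-near : ∀ {ε} x y z → ∣ x - y ∣ < ½ * ε → ∣ y - z ∣ < ½ * ε → ∣ x - z ∣ < ε
      trans-near {ε} x y z p q = subst (λ w → ∣ w ∣ < ε)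
        (solve 3 (λ x y z → (x :- y) :+ (y :- z) := x :- z) refl x y z)
        (sum< (x - y) (y - z) p q)

      *-near : ∀ {B δ ε} x x′ y y′ → 0ℚ < B → B * δ ≡ ½ * ε →
               ∣ x ∣ < B → ∣ y′ ∣ < B → ∣ x - x′ ∣ < δ → ∣ y - y′ ∣ < δ →
               ∣ x * y - x′ * y′ ∣ < ε
      *-near {B} {δ} {ε} x x′ y y′ 0<B Bδ x< y< p q = subst (λ w → ∣ w ∣ < ε)
        (solve 4 (λ x x′ y y′ → x :* (y :- y′) :+ y′ :* (x :- x′) := x :* y :- x′ :* y′)
          refl x x′ y y′)
        (sum< (x * (y - y′)) (y′ * (x - x′))
          (subst (_ <_) Bδ (prod< x (y - y′) 0<B x< q))
          (subst (_ <_) Bδ (prod< y′ (x - x′) 0<B y< p)))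

      divide : ∀ {B ε} → 0ℚ < B → 0ℚ < ε → ∃ λ δ → 0ℚ < δ × B * δ ≡ ½ * ε
      divide {B} {ε} 0<B 0<ε =
        quotient B (½ * ε) {{positive 0<B}} {{positive (half-pos 0<ε)}}
        where
        quotient : ∀ B h .{{_ : ℚ.Positive B}} .{{_ : ℚ.Positive h}} →
                   ∃ λ δ → 0ℚ < δ × B * δ ≡ h
        quotient B h = r * h ,
          ℚₚ.positive⁻¹ (r * h) {{ℚₚ.pos*pos⇒pos r {{ℚₚ.1/pos⇒pos B}} h}} ,
          trans (sym (ℚₚ.*-assoc B r h))
            (trans (cong (_* h) (ℚₚ.*-inverseʳ B {{ℚₚ.pos⇒nonZero B}})) (ℚₚ.*-identityˡ h))
          where
          r : ℚ
          r = (ℚ.1/ B) {{ℚₚ.pos⇒nonZero B}}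

      bounded : (x : ℝ) → ∃ λ B → 0ℚ < B × ∃ λ N → ∀ n → N ℕ.≤ n → ∣ seq x n ∣ < B
      bounded x with cauchy x 1ℚ (ℚₚ.positive⁻¹ 1ℚ)
      ... | N , h = 1ℚ + ∣ seq x N ∣ , 0<B , N , bound
        where
        0<B : 0ℚ < 1ℚ + ∣ seq x N ∣
        0<B = ℚₚ.+-mono-<-≤ (ℚₚ.positive⁻¹ 1ℚ) (ℚₚ.0≤∣p∣ (seq x N))
        bound : ∀ n → N ℕ.≤ n → ∣ seq x n ∣ < 1ℚ + ∣ seq x N ∣
        bound n N≤n = begin-strict
          ∣ seq x n ∣
            ≡⟨ cong ∣_∣ (solve 2 (λ a b → a := (a :- b) :+ b) refl (seq x n) (seq x N)) ⟩
          ∣ (seq x n - seq x N) + seq x N ∣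
            ≤⟨ ℚₚ.∣p+q∣≤∣p∣+∣q∣ (seq x n - seq x N) (seq x N) ⟩
          ∣ seq x n - seq x N ∣ + ∣ seq x N ∣
            <⟨ ℚₚ.+-monoˡ-< ∣ seq x N ∣ (h n N N≤n ℕₚ.≤-refl) ⟩
          1ℚ + ∣ seq x N ∣ ∎

    abstract
      ≤-right : ∀ B C → 0ℚ < C → B ≤ B + C
      ≤-right B C 0<C = begin
        B       ≡⟨ ℚₚ.+-identityʳ B ⟨
        B + 0ℚ  ≤⟨ ℚₚ.+-monoʳ-≤ B (ℚₚ.<⇒≤ 0<C) ⟩
        B + C   ∎

      ≤-left : ∀ B C → 0ℚ < B → C ≤ B + C
      ≤-left B C 0<B = begin
        C       ≡⟨ ℚₚ.+-identityˡ C ⟨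
        0ℚ + C  ≤⟨ ℚₚ.+-monoˡ-≤ C (ℚₚ.<⇒≤ 0<B) ⟩
        B + C   ∎

      bounded₂ : (x y : ℝ) → ∃ λ B → 0ℚ < B × ∃ λ N →
                 ∀ n → N ℕ.≤ n → ∣ seq x n ∣ < B × ∣ seq y n ∣ < B
      bounded₂ x y =
        let B , 0<B , M , f = bounded x
            C , 0<C , N , g = bounded y
        in B + C , ℚₚ.+-mono-< 0<B 0<C , M ℕ.⊔ N , λ n M⊔N≤n →
          ℚₚ.<-≤-trans (f n (ℕₚ.m⊔n≤o⇒m≤o M N M⊔N≤n)) (≤-right B C 0<C) ,
          ℚₚ.<-≤-trans (g n (ℕₚ.m⊔n≤o⇒n≤o M N M⊔N≤n)) (≤-left B C 0<B)

      ≡⇒≈ : ∀ {x y} → (∀ n → seq x n ≡ seq y n) → x ≈ʳ y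
      ≡⇒≈ {x} {y} eq .close ε 0<ε = 0 , λ n _ → subst (_< ε)
        (sym (cong ∣_∣ (trans (cong (_- seq y n) (eq n)) (ℚₚ.+-inverseʳ (seq y n))))) 0<ε

      ≈-sym : ∀ {x y} → x ≈ʳ y → y ≈ʳ x
      ≈-sym {x} {y} p .close ε 0<ε with close p ε 0<ε
      ... | N , f = N , λ n N≤n → swap-near (seq x n) (seq y n) (f n N≤n)

      ≈-trans : ∀ {x y z} → x ≈ʳ y → y ≈ʳ z → x ≈ʳ z
      ≈-trans {x} {y} {z} p q .close ε 0<ε
        with close p (½ * ε) (half-pos 0<ε) | close q (½ * ε) (half-pos 0<ε)
      ... | M , f | N , g = M ℕ.⊔ N , λ n h →
        trans-near (seq x n) (seq y n) (seq z n)
          (f n (ℕₚ.m⊔n≤o⇒m≤o M N h)) (g n (ℕₚ.m⊔n≤o⇒n≤o M N h))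

      const-cauchy : ∀ p → Cauchy (λ _ → p)
      const-cauchy p ε 0<ε = 0 , λ _ _ _ _ →
        subst (_< ε) (sym (cong ∣_∣ (ℚₚ.+-inverseʳ p))) 0<ε

      +-cauchy : ∀ x y → Cauchy (λ n → seq x n + seq y n)
      +-cauchy x y ε 0<ε with cauchy x (½ * ε) (half-pos 0<ε) | cauchy y (½ * ε) (half-pos 0<ε)
      ... | M , f | N , g = M ℕ.⊔ N , λ m n hm hn →
        +-near (seq x m) (seq x n) (seq y m) (seq y n)
          (f m n (ℕₚ.m⊔n≤o⇒m≤o M N hm) (ℕₚ.m⊔n≤o⇒m≤o M N hn))
          (g m n (ℕₚ.m⊔n≤o⇒n≤o M N hm) (ℕₚ.m⊔n≤o⇒n≤o M N hn))

      neg-cauchy : ∀ x → Cauchy (λ n → - seq x n)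
      neg-cauchy x ε 0<ε with cauchy x ε 0<ε
      ... | N , f = N , λ m n hm hn → neg-near (seq x m) (seq x n) (f m n hm hn)

      *-cauchy : ∀ x y → Cauchy (λ n → seq x n * seq y n)
      *-cauchy x y ε 0<ε with bounded₂ x y
      ... | B , 0<B , K , b with divide 0<B 0<ε
      ...   | δ , 0<δ , Bδ with cauchy x δ 0<δ | cauchy y δ 0<δ
      ...     | M , f | N , g = K ℕ.⊔ (M ℕ.⊔ N) , λ m n hm hn →
        let hm′ = ℕₚ.m⊔n≤o⇒n≤o K (M ℕ.⊔ N) hm
            hn′ = ℕₚ.m⊔n≤o⇒n≤o K (M ℕ.⊔ N) hn
        in *-near (seq x m) (seq x n) (seq y m) (seq y n) 0<B Bδ
             (proj₁ (b m (ℕₚ.m⊔n≤o⇒m≤o K (M ℕ.⊔ N) hm)))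
             (proj₂ (b n (ℕₚ.m⊔n≤o⇒m≤o K (M ℕ.⊔ N) hn)))
             (f m n (ℕₚ.m⊔n≤o⇒m≤o M N hm′) (ℕₚ.m⊔n≤o⇒m≤o M N hn′))
             (g m n (ℕₚ.m⊔n≤o⇒n≤o M N hm′) (ℕₚ.m⊔n≤o⇒n≤o M N hn′))

  const : ℚ → ℝ
  const p = mkℝ (λ _ → p) (const-cauchy p)

  infixl 6 _+ʳ_
  infixl 7 _*ʳ_
  infix  8 -ʳ_

  _+ʳ_ : ℝ → ℝ → ℝ
  x +ʳ y = mkℝ (λ n → seq x n + seq y n) (+-cauchy x y)

  -ʳ_ : ℝ → ℝ
  -ʳ x = mkℝ (λ n → - seq x n) (neg-cauchy x)

  _*ʳ_ : ℝ → ℝ → ℝ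
  x *ʳ y = mkℝ (λ n → seq x n * seq y n) (*-cauchy x y)

  private abstract
    +-cong : ∀ {x x′ y y′} → x ≈ʳ x′ → y ≈ʳ y′ → (x +ʳ y) ≈ʳ (x′ +ʳ y′)
    +-cong {x} {x′} {y} {y′} p q .close ε 0<ε
      with close p (½ * ε) (half-pos 0<ε) | close q (½ * ε) (half-pos 0<ε)
    ... | M , f | N , g = M ℕ.⊔ N , λ n h →
      +-near (seq x n) (seq x′ n) (seq y n) (seq y′ n)
        (f n (ℕₚ.m⊔n≤o⇒m≤o M N h)) (g n (ℕₚ.m⊔n≤o⇒n≤o M N h))

    -‿cong : ∀ {x y} → x ≈ʳ y → (-ʳ x) ≈ʳ (-ʳ y)
    -‿cong {x} {y} p .close ε 0<ε with close p ε 0<ε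
    ... | N , f = N , λ n h → neg-near (seq x n) (seq y n) (f n h)

    *-cong : ∀ {x x′ y y′} → x ≈ʳ x′ → y ≈ʳ y′ → (x *ʳ y) ≈ʳ (x′ *ʳ y′)
    *-cong {x} {x′} {y} {y′} p q .close ε 0<ε with bounded₂ x y′
    ... | B , 0<B , K , b with divide 0<B 0<ε
    ...   | δ , 0<δ , Bδ with close p δ 0<δ | close q δ 0<δ
    ...     | M , f | N , g = K ℕ.⊔ (M ℕ.⊔ N) , λ n h →
      let h′ = ℕₚ.m⊔n≤o⇒n≤o K (M ℕ.⊔ N) h
          bn = b n (ℕₚ.m⊔n≤o⇒m≤o K (M ℕ.⊔ N) h)
      in *-near (seq x n) (seq x′ n) (seq y n) (seq y′ n) 0<B Bδ
           (proj₁ bn) (proj₂ bn)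
           (f n (ℕₚ.m⊔n≤o⇒m≤o M N h′)) (g n (ℕₚ.m⊔n≤o⇒n≤o M N h′))

  ℝ-commutativeRing : CommutativeRing 0ℓ 0ℓ
  ℝ-commutativeRing = record
    { Carrier = ℝ
    ; _≈_ = _≈ʳ_
    ; _+_ = _+ʳ_
    ; _*_ = _*ʳ_
    ; -_ = -ʳ_
    ; 0# = const 0ℚ
    ; 1# = const 1ℚ
    ; isCommutativeRing = record
      { isRing = record
        { +-isAbelianGroup = record
          { isGroup = record
            { isMonoid = record
              { isSemigroup = record
                { isMagma = record
                  { isEquivalence = record
                    { refl = ≡⇒≈ λ _ → refl
                    ; sym = ≈-sym
                    ; trans = ≈-trans
                    }
                  ; ∙-cong = +-cong
                  }
                ; assoc = λ x y z → ≡⇒≈ λ n → ℚₚ.+-assoc (seq x n) (seq y n) (seq z n)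
                }
              ; identity = (λ x → ≡⇒≈ λ n → ℚₚ.+-identityˡ (seq x n))
                         , (λ x → ≡⇒≈ λ n → ℚₚ.+-identityʳ (seq x n))
              }
            ; inverse = (λ x → ≡⇒≈ λ n → ℚₚ.+-inverseˡ (seq x n))
                      , (λ x → ≡⇒≈ λ n → ℚₚ.+-inverseʳ (seq x n))
            ; ⁻¹-cong = -‿cong
            }
          ; comm = λ x y → ≡⇒≈ λ n → ℚₚ.+-comm (seq x n) (seq y n)
          }
        ; *-cong = *-cong
        ; *-assoc = λ x y z → ≡⇒≈ λ n → ℚₚ.*-assoc (seq x n) (seq y n) (seq z n)
        ; *-identity = (λ x → ≡⇒≈ λ n → ℚₚ.*-identityˡ (seq x n))
                     , (λ x → ≡⇒≈ λ n → ℚₚ.*-identityʳ (seq x n))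
        ; distrib = (λ x y z → ≡⇒≈ λ n → ℚₚ.*-distribˡ-+ (seq x n) (seq y n) (seq z n))
                  , (λ x y z → ≡⇒≈ λ n → ℚₚ.*-distribʳ-+ (seq x n) (seq y n) (seq z n))
        }
      ; *-comm = λ x y → ≡⇒≈ λ n → ℚₚ.*-comm (seq x n) (seq y n)
      }
    }

-- Friezes with entries in a commutative ring; instantiated at ℝ below.

module Friezes {c ℓ : Level} (R : CommutativeRing c ℓ) where

  open CommutativeRing R using (Carrier; _≈_; 0#; 1#; _+_; _*_; _-_; -_)
  open import Data.Integer.Base using () renaming
    (_+_ to _⊕_; _-_ to _⊖_; -_ to ⊝_; _≤_ to _≤ᶻ_; _<_ to _<ᶻ_)

  data Extent : Set where
    infinite : Extent
    finite   : (N : ℕ) → 3 ℕ.≤ N → Extent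

  InArray : Extent → ℤ → ℤ → Set
  InArray infinite     i j = ⊝ + 2 ≤ᶻ j ⊖ i
  InArray (finite N _) i j = ⊝ + 2 ≤ᶻ j ⊖ i × j ⊖ i ≤ᶻ + N ⊖ + 2

  LastRows : Extent → (ℤ → ℤ → Carrier) → Set ℓ
  LastRows infinite     m = Level.Lift ℓ ⊤
  LastRows (finite N _) m = ∀ i → m i (i ⊕ + N ⊖ + 3) ≈ 1# × m i (i ⊕ + N ⊖ + 2) ≈ 0#

  -- The entries at positions outside the array are junk: no condition on a
  -- frieze, here or below, refers to them.
  record Frieze : Set (c ⊔ ℓ) where
    field
      extent   : Extent
      entry    : ℤ → ℤ → Carrier
      zeros    : ∀ i → entry i (i ⊖ + 2) ≈ 0#
      ones     : ∀ i → entry i (i ⊖ + 1) ≈ 1#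
      diamond  : ∀ i j →
                 InArray extent i j → InArray extent (i ⊕ + 1) (j ⊕ + 1) →
                 InArray extent i (j ⊕ + 1) → InArray extent (i ⊕ + 1) j →
                 entry i j * entry (i ⊕ + 1) (j ⊕ + 1)
                   - entry i (j ⊕ + 1) * entry (i ⊕ + 1) j ≈ 1#
      lastRows : LastRows extent entry

  open Frieze public

  det₃ : (a b c d e f g h k : Carrier) → Carrier
  det₃ a b c d e f g h k =
    a * (e * k - f * h) - b * (d * k - f * g) + c * (d * h - e * g)

  Tame : Frieze → Set ℓ
  Tame F = ∀ i j →
    (∀ (s t : Fin 3) → InArray (extent F) (i ⊕ + Fin.toℕ s) (j ⊕ + Fin.toℕ t)) →
    det₃ (m i j)         (m (i ⊕ + 1) j)         (m (i ⊕ + 2) j)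
         (m i (j ⊕ + 1)) (m (i ⊕ + 1) (j ⊕ + 1)) (m (i ⊕ + 2) (j ⊕ + 1))
         (m i (j ⊕ + 2)) (m (i ⊕ + 1) (j ⊕ + 2)) (m (i ⊕ + 2) (j ⊕ + 2))
      ≈ 0#
    where m = entry F

  Periodic : ℕ → Frieze → Set ℓ
  Periodic n F = ∀ i j → InArray (extent F) i j →
    entry F (i ⊕ + n) (j ⊕ + n) ≈ entry F i j

  quiddity : Frieze → ℤ → Carrier
  quiddity F i = entry F i i

  -- q is indexed from 0, so q k is the quiddity entry a_{k+1}.
  IsQuidditySequence : Frieze → {n : ℕ} → Vector Carrier n → Set ℓ
  IsQuidditySequence F {n} q = ∀ (k : Fin n) → q k ≈ quiddity F (+ ℕ.suc (Fin.toℕ k))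

  Mirrored : Extent → (ℤ → ℤ → Carrier) → Set ℓ
  Mirrored infinite     m = ∀ i j → j ⊖ i <ᶻ ⊝ + 2 → m i j ≈ - m (j ⊕ + 2) (i ⊖ + 2)
  Mirrored (finite N _) m = ∀ i j →
    m i j ≈ - m (j ⊕ + 2) (i ⊖ + 2) × m i j ≈ - m (j ⊖ + N ⊕ + 2) (i ⊕ + N ⊖ + 2)

  record IsLattice (F : Frieze) (m : ℤ → ℤ → Carrier) : Set ℓ where
    field
      extends  : ∀ i j → InArray (extent F) i j → m i j ≈ entry F i j
      mirrored : Mirrored (extent F) m

open Reals public using (ℝ; ℝ-commutativeRing)
open Friezes ℝ-commutativeRing public
open CommutativeRing ℝ-commutativeRing public using (_≈_; _*_; _-_)

{-# OPTIONS --safe #-}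

-- Every row f = m i of the lattice solves the n-periodic recurrence
-- f j + f (j + 2) = m (j + 2) (j + 2) * f (j + 1).  Inside the array, tameness
-- carries the relation from two adjacent columns of a 3 × 3 block to the third,
-- since the minor on the first two block rows of the former is 1; the mirrored
-- parts reduce to this and to the transposed relation.  The rows 2 and 1 form a
-- basis of solutions normalised at the columns -1 and 0, so translation by n
-- acts with trace s and, the Wronskian being constant, with determinant 1.  Now
-- (i) is Cayley–Hamilton and (ii) is its image under the antisymmetry.
module Submission where

open import Algebra.Bundles using (CommutativeRing)
open import Data.Fin.Base as Fin using (Fin; zero; suc)
open import Data.Fin.Properties using (toℕ≤pred[n])
open import Data.Integer.Base as ℤ using (ℤ; +_; -[1+_])
open import Data.Integer.DivMod using (_%ℕ_; _/ℕ_; a≡a%ℕn+[a/ℕn]*n; n%ℕd<d)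
import Data.Integer.Properties as ℤₚ
open import Data.Integer.Tactic.RingSolver using (solve-∀)
open import Data.Maybe.Base as Maybe using (Maybe)
open import Data.Nat.Base as ℕ using (ℕ; zero; suc)
import Data.Nat.Properties as ℕₚ
open import Data.Product.Base using (_×_; _,_; proj₁; proj₂)
open import Data.Sum.Base using (inj₁; inj₂)
open import Data.Unit.Base using (⊤; tt)
open import Data.Vec.Functional using (Vector)
import Relation.Binary.PropositionalEquality as ≡
open ≡ using (_≡_)
open import Relation.Nullary.Decidable.Core using (yes; no; dec⇒maybe)
import Defs

-- Ring solver over an arbitrary commutative ring, with integer coefficients.

module IntegerCoefficients {c ℓ} (R : CommutativeRing c ℓ) where

  open CommutativeRing R
  open import Algebra.Properties.Ring ring
  open import Algebra.Properties.AbelianGroup +-abelianGroup using (⁻¹-∙-comm)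
  open import Algebra.Properties.Semiring.Mult.TCOptimised semiring
    using (1+×; ×-homo-+; ×1-homo-*) renaming (_×_ to _×ᴿ_)
  open import Algebra.Solver.Ring.AlmostCommutativeRing
    using (_-Raw-AlmostCommutative⟶_; fromCommutativeRing)
  open import Relation.Binary.Reasoning.Setoid setoid

  private
    -- The coefficients are integers rather than ring elements because the
    -- solver cancels terms only if equality of coefficients is decidable.
    ⟦_⟧ : ℤ → Carrier
    ⟦ + n ⟧      = n ×ᴿ 1#
    ⟦ -[1+ n ] ⟧ = - (suc n ×ᴿ 1#)

    neg-homo : ∀ i → ⟦ ℤ.- i ⟧ ≈ - ⟦ i ⟧
    neg-homo (+ zero)   = sym -0#≈0#
    neg-homo (+ suc n)  = refl
    neg-homo -[1+ n ]   = sym (-‿involutive _)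

    cancel : ∀ x y z → y - z ≈ (x + y) - (x + z)
    cancel x y z = begin
      y - z                    ≈⟨ +-congʳ (+-identityˡ y) ⟨
      0# + y - z               ≈⟨ +-congʳ (+-congʳ (-‿inverseˡ x)) ⟨
      (- x + x) + y - z        ≈⟨ +-congʳ (+-assoc _ _ _) ⟩
      - x + (x + y) - z        ≈⟨ +-congʳ (+-comm _ _) ⟩
      (x + y) + - x - z        ≈⟨ +-assoc _ _ _ ⟩
      (x + y) + (- x - z)      ≈⟨ +-congˡ (⁻¹-∙-comm x z) ⟩
      (x + y) - (x + z)        ∎

    ⊖-homo : ∀ m n → ⟦ m ℤ.⊖ n ⟧ ≈ m ×ᴿ 1# - n ×ᴿ 1#
    ⊖-homo zero    zero    = sym (-‿inverseʳ 0#)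
    ⊖-homo zero    (suc n) = sym (+-identityˡ _)
    ⊖-homo (suc m) zero    = sym (trans (+-congˡ -0#≈0#) (+-identityʳ _))
    ⊖-homo (suc m) (suc n) = begin
      ⟦ suc m ℤ.⊖ suc n ⟧                    ≡⟨ ≡.cong ⟦_⟧ (ℤₚ.[1+m]⊖[1+n]≡m⊖n m n) ⟩
      ⟦ m ℤ.⊖ n ⟧                            ≈⟨ ⊖-homo m n ⟩
      m ×ᴿ 1# - n ×ᴿ 1#                      ≈⟨ cancel 1# _ _ ⟩
      (1# + m ×ᴿ 1#) - (1# + n ×ᴿ 1#)        ≈⟨ +-cong (1+× m 1#) (-‿cong (1+× n 1#)) ⟨
      suc m ×ᴿ 1# - suc n ×ᴿ 1#              ∎

    +-homo : ∀ i j → ⟦ i ℤ.+ j ⟧ ≈ ⟦ i ⟧ + ⟦ j ⟧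
    +-homo (+ m)    (+ n)    = ×-homo-+ 1# m n
    +-homo (+ m)    -[1+ n ] = ⊖-homo m (suc n)
    +-homo -[1+ m ] (+ n)    = trans (⊖-homo n (suc m)) (+-comm _ _)
    +-homo -[1+ m ] -[1+ n ] = begin
      - (suc (suc (m ℕ.+ n)) ×ᴿ 1#)      ≡⟨ ≡.cong (λ k → - (k ×ᴿ 1#)) (≡.sym (≡.cong suc (ℕₚ.+-suc m n))) ⟩
      - ((suc m ℕ.+ suc n) ×ᴿ 1#)        ≈⟨ -‿cong (×-homo-+ 1# (suc m) (suc n)) ⟩
      - (suc m ×ᴿ 1# + suc n ×ᴿ 1#)       ≈⟨ ⁻¹-∙-comm _ _ ⟨
      - (suc m ×ᴿ 1#) - (suc n ×ᴿ 1#)     ∎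

    pos-*-homo : ∀ m j → ⟦ + m ℤ.* j ⟧ ≈ m ×ᴿ 1# * ⟦ j ⟧
    pos-*-homo m (+ n) = trans (reflexive (≡.cong ⟦_⟧ (≡.sym (ℤₚ.pos-* m n)))) (×1-homo-* m n)
    pos-*-homo m -[1+ n ] = begin
      ⟦ + m ℤ.* -[1+ n ] ⟧           ≡⟨ ≡.cong ⟦_⟧ (ℤₚ.neg-distribʳ-* (+ m) (+ suc n)) ⟨
      ⟦ ℤ.- (+ m ℤ.* + suc n) ⟧      ≈⟨ neg-homo (+ m ℤ.* + suc n) ⟩
      - ⟦ + m ℤ.* + suc n ⟧          ≈⟨ -‿cong (pos-*-homo m (+ suc n)) ⟩
      - (m ×ᴿ 1# * (suc n ×ᴿ 1#))      ≈⟨ -‿distribʳ-* _ _ ⟩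
      m ×ᴿ 1# * - (suc n ×ᴿ 1#)        ∎

    *-homo : ∀ i j → ⟦ i ℤ.* j ⟧ ≈ ⟦ i ⟧ * ⟦ j ⟧
    *-homo (+ m)    j = pos-*-homo m j
    *-homo -[1+ m ] j = begin
      ⟦ -[1+ m ] ℤ.* j ⟧             ≡⟨ ≡.cong ⟦_⟧ (ℤₚ.neg-distribˡ-* (+ suc m) j) ⟨
      ⟦ ℤ.- (+ suc m ℤ.* j) ⟧        ≈⟨ neg-homo (+ suc m ℤ.* j) ⟩
      - ⟦ + suc m ℤ.* j ⟧            ≈⟨ -‿cong (pos-*-homo (suc m) j) ⟩
      - (suc m ×ᴿ 1# * ⟦ j ⟧)         ≈⟨ -‿distribˡ-* _ _ ⟩
      - (suc m ×ᴿ 1#) * ⟦ j ⟧         ∎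

    homomorphism : CommutativeRing.rawRing ℤₚ.+-*-commutativeRing
                     -Raw-AlmostCommutative⟶ fromCommutativeRing R
    homomorphism = record
      { ⟦_⟧    = ⟦_⟧
      ; +-homo = +-homo
      ; *-homo = *-homo
      ; -‿homo = neg-homo
      ; 0-homo = refl
      ; 1-homo = refl
      }

    _≟_ : ∀ i j → Maybe (⟦ i ⟧ ≈ ⟦ j ⟧)
    i ≟ j = Maybe.map (λ i≡j → reflexive (≡.cong ⟦_⟧ i≡j)) (dec⇒maybe (i ℤₚ.≟ j))

  open import Algebra.Solver.Ring _ _ homomorphism _≟_ public
    using (solve; con; _:+_; _:*_; _:-_; :-_; _:=_)

-- Two-sided induction on the integers; linear combinations of equations.

ℤ-induction : ∀ {p} (P : ℤ → Set p) →
              P (+ 0) → (∀ j → P j → P (j ℤ.+ + 1)) → (∀ j → P (j ℤ.+ + 1) → P j) →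
              ∀ j → P j
ℤ-induction P base up down (+ zero)     = base
ℤ-induction P base up down (+ suc n)    =
  -- For a variable `n` the index `+ n ℤ.+ + 1` only computes to `+ (n ℕ.+ 1)`. The negative cases
  -- below need no transport, as adding one to a negative literal computes.
  ≡.subst (λ k → P (+ k)) (ℕₚ.+-comm n 1) (up (+ n) (ℤ-induction P base up down (+ n)))
ℤ-induction P base up down -[1+ zero ]  = down -[1+ 0 ] base
ℤ-induction P base up down -[1+ suc n ] =
  down -[1+ suc n ] (ℤ-induction P base up down -[1+ n ])

module LinearReasoning {c ℓ} (R : CommutativeRing c ℓ) where

  open CommutativeRing R
  open import Algebra.Properties.Group +-group using (∙-cancelʳ)

  infixl 6 _⊞_
  infixr 7 _⊡_

  _⊞_ : ∀ {x y z w} → x ≈ y → z ≈ w → x + z ≈ y + w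
  _⊞_ = +-cong

  _⊡_ : ∀ k {x y} → x ≈ y → k * x ≈ k * y
  k ⊡ eq = *-congˡ eq

  -- To derive z ≈ w, give a linear combination x ≈ y of known equations whose
  -- difference x - y equals z - w; the second argument is then a ring identity.
  linear : ∀ {x y z w} → x ≈ y → z + y ≈ w + x → z ≈ w
  linear {x} {y} {z} {w} eq h = ∙-cancelʳ y z w (trans h (+-congˡ eq))

-- Second-order linear recurrences on the integers and their monodromy.

module Recurrence {c ℓ} (R : CommutativeRing c ℓ) where

  open CommutativeRing R
  open IntegerCoefficients R
  open LinearReasoning R
  open import Data.Integer.Base using () renaming (_+_ to _⊕_; _-_ to _⊖_)

  IsSolution : (b f : ℤ → Carrier) → Set ℓ
  IsSolution b f = ∀ j → f j + f (j ⊕ + 2) ≈ b j * f (j ⊕ + 1)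

  at : ∀ (f : ℤ → Carrier) {i j} → i ≡ j → f i ≈ f j
  at f eq = reflexive (≡.cong f eq)

  j+1+1 : ∀ j → j ⊕ + 1 ⊕ + 1 ≡ j ⊕ + 2
  j+1+1 = solve-∀

  module _ {b : ℤ → Carrier} where

    -- The index is spelled `j ⊕ + 1 ⊕ + 1` to match the step of `ℤ-induction`, where `j` is
    -- replaced by `j ⊕ + 1`.
    next : ∀ {f} → IsSolution b f → ∀ j → f (j ⊕ + 1 ⊕ + 1) ≈ b j * f (j ⊕ + 1) - f j
    next {f} sf j = linear (at f (j+1+1 j) ⊞ sf j)
      (solve 4 (λ y z w x → y :+ (z :+ w) := (w :- x) :+ (y :+ (x :+ z))) refl _ _ _ _)

    previous : ∀ {f} → IsSolution b f → ∀ j → f j ≈ b j * f (j ⊕ + 1) - f (j ⊕ + 1 ⊕ + 1)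
    previous {f} sf j = linear (next sf j)
      (solve 3 (λ x y z → x :+ (y :- x) := (y :- z) :+ z) refl _ _ _)

    -- Both outer terms of the recurrence have coefficient 1, so two adjacent values determine a
    -- solution in either direction.
    unique : ∀ {f g} → IsSolution b f → IsSolution b g →
             f -[1+ 0 ] ≈ g -[1+ 0 ] → f (+ 0) ≈ g (+ 0) → ∀ j → f j ≈ g j
    unique {f} {g} sf sg eq₋₁ eq₀ j =
      -- The initial values give agreement at -1, and `up` carries it to 0, where the induction
      -- starts.
      proj₁ (ℤ-induction Agree (up -[1+ 0 ] (eq₋₁ , eq₀)) up down j)
      where
      Agree : ℤ → Set ℓ
      Agree j = f j ≈ g j × f (j ⊕ + 1) ≈ g (j ⊕ + 1)

      up : ∀ j → Agree j → Agree (j ⊕ + 1)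
      up j (eq , eq′) = eq′ ,
        trans (next sf j) (trans (+-cong (*-congˡ eq′) (-‿cong eq)) (sym (next sg j)))

      down : ∀ j → Agree (j ⊕ + 1) → Agree j
      down j (eq , eq′) =
        trans (previous sf j) (trans (+-cong (*-congˡ eq) (-‿cong eq′)) (sym (previous sg j))) , eq

    combination : ∀ {f g} x y → IsSolution b f → IsSolution b g →
                  IsSolution b (λ j → x * f j + y * g j)
    combination x y sf sg j = linear (x ⊡ sf j ⊞ y ⊡ sg j)
      (solve 9 (λ x f₀ f₂ bj f₁ y g₀ g₁ g₂ →
        ((x :* f₀ :+ y :* g₀) :+ (x :* f₂ :+ y :* g₂))
          :+ (x :* (bj :* f₁) :+ y :* (bj :* g₁))
        := bj :* (x :* f₁ :+ y :* g₁)
          :+ (x :* (f₀ :+ f₂) :+ y :* (g₀ :+ g₂))) refl _ _ _ _ _ _ _ _ _)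

    -- One step of the recurrence acts on adjacent pairs by a matrix of determinant 1.
    wronskian : ∀ {u v} → IsSolution b u → IsSolution b v → ∀ j →
                u (j ⊕ + 1) * v j - v (j ⊕ + 1) * u j
                  ≈ u (+ 0) * v -[1+ 0 ] - v (+ 0) * u -[1+ 0 ]
    wronskian {u} {v} su sv = ℤ-induction _ (step -[1+ 0 ])
      (λ j eq → trans (step j) eq) (λ j eq → trans (sym (step j)) eq)
      where
      step : ∀ j → u (j ⊕ + 1 ⊕ + 1) * v (j ⊕ + 1) - v (j ⊕ + 1 ⊕ + 1) * u (j ⊕ + 1)
                     ≈ u (j ⊕ + 1) * v j - v (j ⊕ + 1) * u j
      step j = trans
        (+-cong (*-congʳ (next su j)) (-‿cong (*-congʳ (next sv j))))
        (solve 5 (λ bj u₀ u₁ v₀ v₁ →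
          (bj :* u₁ :- u₀) :* v₁ :- (bj :* v₁ :- v₀) :* u₁ := u₁ :* v₀ :- v₁ :* u₀)
          refl _ _ _ _ _)

    shift : ∀ {f} p → (∀ j → b (j ⊕ p) ≈ b j) →
            IsSolution b f → IsSolution b (λ j → f (j ⊕ p))
    shift {f} p periodic sf j = trans
      (+-congˡ (at f (swap j (+ 2) p)))
      (trans (sf (j ⊕ p)) (*-cong (periodic j) (at f (≡.sym (swap j (+ 1) p)))))
      where
      swap : ∀ j k p → j ⊕ k ⊕ p ≡ j ⊕ p ⊕ k
      swap = solve-∀

    module _ {u v : ℤ → Carrier} (su : IsSolution b u) (sv : IsSolution b v)
             (u₋₁ : u -[1+ 0 ] ≈ 0#) (u₀ : u (+ 0) ≈ 1#)
             (v₋₁ : v -[1+ 0 ] ≈ - 1#) (v₀ : v (+ 0) ≈ 0#) where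

      -- The basis is dual to the values at 0 and, up to sign, at -1. Hence the minus sign in the
      -- second coefficient.
      expand : ∀ {f} → IsSolution b f → ∀ j → f j ≈ f (+ 0) * u j + - f -[1+ 0 ] * v j
      expand {f} sf = unique sf (combination _ _ su sv)
        (sym (trans (+-cong (*-congˡ u₋₁) (*-congˡ v₋₁))
          (solve 2 (λ x y → x :* con (+ 0) :+ :- y :* :- con (+ 1) := y) refl _ _)))
        (sym (trans (+-cong (*-congˡ u₀) (*-congˡ v₀))
          (solve 2 (λ x y → x :* con (+ 1) :+ :- y :* con (+ 0) := x) refl _ _)))

      -- Cayley–Hamilton for the monodromy matrix of the period p, whose
      -- determinant is the Wronskian of u and v.
      monodromy : ∀ p → (∀ j → b (j ⊕ p) ≈ b j) → ∀ {f} → IsSolution b f →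
                  ∀ j → f (j ⊕ p ⊕ p) ≈ (u p - v (p ⊖ + 1)) * f (j ⊕ p) - f j
      monodromy p periodic {f} sf j = trans
        (unique (shift p periodic sf′) (combination s (- 1#) sf′ sf) base₋₁ base₀ j)
        (solve 3 (λ s x y → s :* x :+ :- con (+ 1) :* y := s :* x :- y) refl _ _ _)
        where
        -- By `expand`, translation by `p` acts on the values at 0 and -1 by the matrix with rows
        -- `u p`, `- v p` and `u (p ⊖ + 1)`, `- v (p ⊖ + 1)`; this is its trace.
        s = u p - v (p ⊖ + 1)

        sf′ : IsSolution b (λ j → f (j ⊕ p))
        sf′ = shift p periodic sf

        index₀ : ∀ p → p ≡ + 0 ⊕ p
        index₀ = solve-∀

        index₋₁ : ∀ p → p ⊖ + 1 ≡ -[1+ 0 ] ⊕ p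
        index₋₁ = solve-∀

        index-suc : ∀ p → p ⊖ + 1 ⊕ + 1 ≡ p
        index-suc = solve-∀

        expand₀ : f (+ 0 ⊕ p) ≈ f (+ 0) * u p + - f -[1+ 0 ] * v p
        expand₀ = trans (at f (≡.sym (index₀ p))) (expand sf p)

        expand₋₁ : f (-[1+ 0 ] ⊕ p) ≈
                   f (+ 0) * u (p ⊖ + 1) + - f -[1+ 0 ] * v (p ⊖ + 1)
        expand₋₁ = trans (at f (≡.sym (index₋₁ p))) (expand sf (p ⊖ + 1))

        expand′₀ : f (+ 0 ⊕ p ⊕ p) ≈ f (+ 0 ⊕ p) * u p + - f (-[1+ 0 ] ⊕ p) * v p
        expand′₀ = trans (at (λ j → f (j ⊕ p)) (≡.sym (index₀ p))) (expand sf′ p)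

        expand′₋₁ : f (-[1+ 0 ] ⊕ p ⊕ p) ≈
                    f (+ 0 ⊕ p) * u (p ⊖ + 1) + - f (-[1+ 0 ] ⊕ p) * v (p ⊖ + 1)
        expand′₋₁ = trans (at (λ j → f (j ⊕ p)) (≡.sym (index₋₁ p))) (expand sf′ (p ⊖ + 1))

        determinant : u p * v (p ⊖ + 1) - v p * u (p ⊖ + 1) ≈ - 1#
        determinant = trans
          (+-cong (*-congʳ (at u (≡.sym (index-suc p))))
                  (-‿cong (*-congʳ (at v (≡.sym (index-suc p))))))
          (trans (wronskian su sv (p ⊖ + 1))
          (trans (+-cong (*-cong u₀ v₋₁) (-‿cong (*-cong v₀ u₋₁)))
            (solve 0 (con (+ 1) :* :- con (+ 1) :- con (+ 0) :* con (+ 0) := :- con (+ 1)) refl)))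

        base₀ : f (+ 0 ⊕ p ⊕ p) ≈ s * f (+ 0 ⊕ p) + - 1# * f (+ 0)
        base₀ = linear
          -- The multiples of `expand₀` and `expand₋₁` eliminate `f (-[1+ 0 ] ⊕ p)`. In them
          -- `f -[1+ 0 ]` cancels and `f (+ 0)` acquires the determinant as its factor.
          (expand′₀ ⊞ v (p ⊖ + 1) ⊡ expand₀ ⊞ v p ⊡ sym expand₋₁ ⊞ f (+ 0) ⊡ determinant)
          (solve 9 (λ x y U U′ V V′ z z′ w →
            w :+ (z :* U :+ :- z′ :* V :+ V′ :* (x :* U :+ :- y :* V) :+ V :* z′
                    :+ x :* :- con (+ 1))
            := ((U :- V′) :* z :+ :- con (+ 1) :* x)
              :+ (w :+ V′ :* z :+ V :* (x :* U′ :+ :- y :* V′)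
                    :+ x :* (U :* V′ :- V :* U′)))
            refl _ _ _ _ _ _ _ _ _)

        base₋₁ : f (-[1+ 0 ] ⊕ p ⊕ p) ≈ s * f (-[1+ 0 ] ⊕ p) + - 1# * f -[1+ 0 ]
        base₋₁ = linear
          (expand′₋₁ ⊞ u (p ⊖ + 1) ⊡ expand₀ ⊞ u p ⊡ sym expand₋₁ ⊞ f -[1+ 0 ] ⊡ determinant)
          (solve 9 (λ x y U U′ V V′ z z′ w →
            w :+ (z :* U′ :+ :- z′ :* V′ :+ U′ :* (x :* U :+ :- y :* V) :+ U :* z′
                    :+ y :* :- con (+ 1))
            := ((U :- V′) :* z′ :+ :- con (+ 1) :* y)
              :+ (w :+ U′ :* z :+ U :* (x :* U′ :+ :- y :* V′)
                    :+ y :* (U :* V′ :- V :* U′)))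
            refl _ _ _ _ _ _ _ _ _)

-- Tame friezes: relations along rows and columns of the array and of its lattice.

module Lattices {c ℓ} (R : CommutativeRing c ℓ) where

  open import Data.Integer.Base using ()
    renaming (_+_ to _⊕_; _-_ to _⊖_; -_ to ⊝_; _*_ to _⊛_)
  open CommutativeRing R
  open IntegerCoefficients R
  open LinearReasoning R
  open Recurrence R using (monodromy)
  open Defs.Friezes R

  -- Adding the first row and `- x` times the second to the third turns the latter into
  -- `a₀ + a₂ - x * a₁`, 0, 0. The determinant is therefore this entry times its cofactor, the given
  -- minor 1.
  det₃-first-column : ∀ {x} a₀ b₀ c₀ a₁ b₁ c₁ a₂ b₂ c₂ →
    det₃ a₀ b₀ c₀ a₁ b₁ c₁ a₂ b₂ c₂ ≈ 0# → b₀ * c₁ - b₁ * c₀ ≈ 1# →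
    b₀ + b₂ ≈ x * b₁ → c₀ + c₂ ≈ x * c₁ → a₀ + a₂ ≈ x * a₁
  det₃-first-column {x} a₀ b₀ c₀ a₁ b₁ c₁ a₂ b₂ c₂ det minor b c = linear
    -- The multipliers of `b` and `c` are, up to sign, the other cofactors of the last row.
    (det ⊞ (a₀ * c₁ - c₀ * a₁) ⊡ b ⊞ (a₀ * b₁ - b₀ * a₁) ⊡ sym c
      ⊞ (a₀ + a₂ - x * a₁) ⊡ sym minor)
    (solve 10 (λ x a₀ b₀ c₀ a₁ b₁ c₁ a₂ b₂ c₂ →
      (a₀ :+ a₂) :+ (con (+ 0) :+ (a₀ :* c₁ :- c₀ :* a₁) :* (x :* b₁)
          :+ (a₀ :* b₁ :- b₀ :* a₁) :* (c₀ :+ c₂)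
          :+ (a₀ :+ a₂ :- x :* a₁) :* (b₀ :* c₁ :- b₁ :* c₀))
      := x :* a₁ :+ (a₀ :* (b₁ :* c₂ :- c₁ :* b₂) :- b₀ :* (a₁ :* c₂ :- c₁ :* a₂)
            :+ c₀ :* (a₁ :* b₂ :- b₁ :* a₂)
          :+ (a₀ :* c₁ :- c₀ :* a₁) :* (b₀ :+ b₂)
          :+ (a₀ :* b₁ :- b₀ :* a₁) :* (x :* c₁)
          :+ (a₀ :+ a₂ :- x :* a₁) :* con (+ 1)))
      refl x a₀ b₀ c₀ a₁ b₁ c₁ a₂ b₂ c₂)

  -- The transposed argument: replacing the first column by first plus third minus `x` times the
  -- second leaves only its bottom entry, whose cofactor is the minor 1.
  det₃-last-row : ∀ {x} a₀ b₀ c₀ a₁ b₁ c₁ a₂ b₂ c₂ →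
    det₃ a₀ b₀ c₀ a₁ b₁ c₁ a₂ b₂ c₂ ≈ 0# → b₀ * c₁ - b₁ * c₀ ≈ 1# →
    a₀ + c₀ ≈ x * b₀ → a₁ + c₁ ≈ x * b₁ → a₂ + c₂ ≈ x * b₂
  det₃-last-row {x} a₀ b₀ c₀ a₁ b₁ c₁ a₂ b₂ c₂ det minor r₀ r₁ = linear
    (det ⊞ (b₁ * c₂ - c₁ * b₂) ⊡ sym r₀ ⊞ (b₀ * c₂ - c₀ * b₂) ⊡ r₁
      ⊞ (a₂ + c₂ - x * b₂) ⊡ sym minor)
    (solve 10 (λ x a₀ b₀ c₀ a₁ b₁ c₁ a₂ b₂ c₂ →
      (a₂ :+ c₂) :+ (con (+ 0) :+ (b₁ :* c₂ :- c₁ :* b₂) :* (a₀ :+ c₀)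
          :+ (b₀ :* c₂ :- c₀ :* b₂) :* (x :* b₁)
          :+ (a₂ :+ c₂ :- x :* b₂) :* (b₀ :* c₁ :- b₁ :* c₀))
      := x :* b₂ :+ (a₀ :* (b₁ :* c₂ :- c₁ :* b₂) :- b₀ :* (a₁ :* c₂ :- c₁ :* a₂)
            :+ c₀ :* (a₁ :* b₂ :- b₁ :* a₂)
          :+ (b₁ :* c₂ :- c₁ :* b₂) :* (x :* b₀)
          :+ (b₀ :* c₂ :- c₀ :* b₂) :* (a₁ :+ c₁)
          :+ (a₂ :+ c₂ :- x :* b₂) :* con (+ 1)))
      refl x a₀ b₀ c₀ a₁ b₁ c₁ a₂ b₂ c₂)

  -- The position (i, j) lies in the row number d of the array, counted from 0
  -- at the row of zeros.
  record Offset (i j : ℤ) (d : ℕ) : Set where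
    constructor offset
    field
      position : j ⊕ + 2 ≡ i ⊕ + d

  open Offset

  -- In a finite array the closing ones and zeros are the rows number `N - 1` and `N`.
  Within : Extent → ℕ → Set
  Within infinite     d = ⊤
  Within (finite N _) d = d ℕ.≤ N

  within-≤ : ∀ e {d d′} → d ℕ.≤ d′ → Within e d′ → Within e d
  within-≤ infinite     d≤d′ w = tt
  within-≤ (finite N _) d≤d′ w = ℕₚ.≤-trans d≤d′ w

  within-3 : ∀ e → Within e 3
  within-3 infinite       = tt
  within-3 (finite N 3≤N) = 3≤N

  offset-difference : ∀ {i j d} → Offset i j d → j ⊖ i ≡ + d ⊖ + 2
  offset-difference {i} {j} {d} o =
    ≡.trans (lhs i j) (≡.trans (≡.cong (λ k → k ⊖ i ⊖ + 2) (position o)) (rhs i (+ d)))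
    where
    lhs : ∀ i j → j ⊖ i ≡ (j ⊕ + 2) ⊖ i ⊖ + 2
    lhs = solve-∀
    rhs : ∀ i d → (i ⊕ d) ⊖ i ⊖ + 2 ≡ d ⊖ + 2
    rhs = solve-∀

  offset-column : ∀ {i j d} → Offset i j d → j ≡ i ⊕ + d ⊖ + 2
  offset-column {i} {j} o = ≡.trans (lhs j) (≡.cong (_⊖ + 2) (position o))
    where
    lhs : ∀ j → j ≡ j ⊕ + 2 ⊖ + 2
    lhs = solve-∀

  offset→ : ∀ {i j d} t → Offset i j d → Offset i (j ⊕ + t) (t ℕ.+ d)
  offset→ {i} {j} {d} t o = offset
    (≡.trans (lhs j (+ t)) (≡.trans (≡.cong (_⊕ + t) (position o)) (rhs i (+ d) (+ t))))
    where
    lhs : ∀ j t → j ⊕ t ⊕ + 2 ≡ j ⊕ + 2 ⊕ t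
    lhs = solve-∀
    rhs : ∀ i d t → i ⊕ d ⊕ t ≡ i ⊕ (t ⊕ d)
    rhs = solve-∀

  offset← : ∀ {i j d} t → Offset i j (t ℕ.+ d) → Offset i (j ⊖ + t) d
  offset← {i} {j} {d} t o = offset
    (≡.trans (lhs j (+ t)) (≡.trans (≡.cong (_⊖ + t) (position o)) (rhs i (+ d) (+ t))))
    where
    lhs : ∀ j t → j ⊖ t ⊕ + 2 ≡ j ⊕ + 2 ⊖ t
    lhs = solve-∀
    rhs : ∀ i d t → i ⊕ (t ⊕ d) ⊖ t ≡ i ⊕ d
    rhs = solve-∀

  offset↓ : ∀ {i j d} s → Offset i j (s ℕ.+ d) → Offset (i ⊕ + s) j d
  offset↓ {i} {j} {d} s o = offset (≡.trans (position o) (≡.sym (ℤₚ.+-assoc i (+ s) (+ d))))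

  inArray : ∀ e {i j d} → Offset i j d → Within e d → InArray e i j
  inArray infinite {d = d} o w =
    ≡.subst (⊝ + 2 ℤ.≤_) (≡.sym (offset-difference o)) (ℤₚ.+-monoˡ-≤ (⊝ + 2) (ℤ.+≤+ (ℕ.z≤n {d})))
  inArray (finite N 3≤N) {d = d} o w =
    inArray infinite o tt ,
    ≡.subst (ℤ._≤ + N ⊖ + 2) (≡.sym (offset-difference o)) (ℤₚ.+-monoˡ-≤ (⊝ + 2) (ℤ.+≤+ w))

  -- Over all `j`, `RowRelation m i` is by definition `IsSolution` for `m i`, with the shifted
  -- quiddity row as coefficients. The two relations are exchanged by the antisymmetry.
  RowRelation ColumnRelation : (ℤ → ℤ → Carrier) → ℤ → ℤ → Set ℓ
  RowRelation    m i j = m i j + m i (j ⊕ + 2) ≈ m (j ⊕ + 2) (j ⊕ + 2) * m i (j ⊕ + 1)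
  ColumnRelation m i j = m i j + m (i ⊕ + 2) j ≈ m i i * m (i ⊕ + 1) j

  index-+1+1 : ∀ i → i ⊕ + 1 ⊕ + 1 ≡ i ⊕ + 2
  index-+1+1 = solve-∀

  [i⊕k]⊖k≡i : ∀ i k → i ⊕ k ⊖ k ≡ i
  [i⊕k]⊖k≡i = solve-∀

  [j⊖k]⊕k≡j : ∀ j k → j ⊖ k ⊕ k ≡ j
  [j⊖k]⊕k≡j = solve-∀

  at₂ : ∀ (m : ℤ → ℤ → Carrier) {i i′ j j′} → i ≡ i′ → j ≡ j′ → m i j ≈ m i′ j′
  at₂ m p q = reflexive (≡.cong₂ m p q)

  -- Relations inside the array, by induction on the row number.

  module TameFrieze (F : Frieze) (tame : Tame F) where

    private
      e = extent F
      E = entry F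

    zero-at : ∀ {i j} → Offset i j 0 → E i j ≈ 0#
    zero-at {i} {j} o = trans (at₂ E ≡.refl (≡.trans (offset-column o) (index i))) (zeros F i)
      where
      index : ∀ i → i ⊕ + 0 ⊖ + 2 ≡ i ⊖ + 2
      index = solve-∀

    one-at : ∀ {i j} → Offset i j 1 → E i j ≈ 1#
    one-at {i} {j} o = trans (at₂ E ≡.refl (≡.trans (offset-column o) (index i))) (ones F i)
      where
      index : ∀ i → i ⊕ + 1 ⊖ + 2 ≡ i ⊖ + 1
      index = solve-∀

    -- The four entries lie in the rows number `d`, `1 + d` (twice) and `2 + d`, so one bound
    -- suffices.
    diamond-at : ∀ {i i′ j j′ d} → Offset i j (1 ℕ.+ d) → Within e (2 ℕ.+ d) →
                 i ⊕ + 1 ≡ i′ → j ⊕ + 1 ≡ j′ →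
                 E i j * E i′ j′ - E i j′ * E i′ j ≈ 1#
    diamond-at {i} {j = j} {d = d} o w ≡.refl ≡.refl = diamond F i j
      (inArray e o w₁)
      (inArray e (offset↓ 1 (offset→ 1 o)) w₁)
      (inArray e (offset→ 1 o) w)
      (inArray e (offset↓ 1 o) (within-≤ e (ℕₚ.n≤1+n d) w₁))
      where
      w₁ : Within e (1 ℕ.+ d)
      w₁ = within-≤ e (ℕₚ.n≤1+n (suc d)) w

    -- The block meets the rows number `d` to `4 + d`: moving along `i` lowers the number, moving
    -- along `j` raises it.
    block-inArray : ∀ {i j d} → Offset i j (2 ℕ.+ d) → Within e (4 ℕ.+ d) →
                    ∀ (s t : Fin 3) → InArray e (i ⊕ + Fin.toℕ s) (j ⊕ + Fin.toℕ t)
    block-inArray {i} {j} {d} o w s t = at-column s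
      where
      k = Fin.toℕ t ℕ.+ d

      k≤2+d : k ℕ.≤ 2 ℕ.+ d
      k≤2+d = ℕₚ.+-monoˡ-≤ d (toℕ≤pred[n] t)

      o′ : Offset i (j ⊕ + Fin.toℕ t) (2 ℕ.+ k)
      o′ = ≡.subst (Offset i (j ⊕ + Fin.toℕ t))
        (≡.trans (ℕₚ.+-suc (Fin.toℕ t) (suc d)) (≡.cong suc (ℕₚ.+-suc (Fin.toℕ t) d)))
        (offset→ (Fin.toℕ t) o)

      w₂ : Within e (2 ℕ.+ k)
      w₂ = within-≤ e (ℕ.s≤s (ℕ.s≤s k≤2+d)) w

      w₁ : Within e (1 ℕ.+ k)
      w₁ = within-≤ e (ℕₚ.n≤1+n _) w₂

      at-column : ∀ s → InArray e (i ⊕ + Fin.toℕ s) (j ⊕ + Fin.toℕ t)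
      at-column zero             = inArray e (offset↓ 0 o′) w₂
      at-column (suc zero)       = inArray e (offset↓ 1 o′) w₁
      at-column (suc (suc zero)) = inArray e (offset↓ 2 o′) (within-≤ e (ℕₚ.n≤1+n _) w₁)

    -- Two-step induction: tameness passes the relation from `i ⊕ + 1` and `i ⊕ + 2`, where the row
    -- number is smaller by 1 and 2, to `i`. For number 0 the border of zeros and ones gives it, for
    -- number 1 the diamond rule.
    row : ∀ d {i j} → Offset i j d → Within e (2 ℕ.+ d) → RowRelation E i j
    row zero {i} {j} o w = linear
      (zero-at o ⊞ at₂ E (≡.trans (≡.sym (ℤₚ.+-identityʳ i)) (≡.sym (position o))) ≡.refl
        ⊞ E (j ⊕ + 2) (j ⊕ + 2) ⊡ sym (one-at (offset→ 1 o)))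
      (solve 4 (λ x y z w →
        (x :+ y) :+ (con (+ 0) :+ z :+ z :* w) := z :* w :+ (x :+ y :+ z :* con (+ 1)))
        refl _ _ _ _)
    row (suc zero) {i} {j} o w = linear
      (one-at o ⊞ sym (diamond-at (offset→ 1 o) w ≡.refl (index-+1+1 j))
        ⊞ E i (j ⊕ + 1) ⊡ at₂ E i⊕1≡j⊕2 ≡.refl
        ⊞ E i (j ⊕ + 2) ⊡ sym (one-at (offset↓ 1 (offset→ 1 o))))
      (solve 6 (λ x y z v a b →
        (x :+ y) :+ (con (+ 1) :+ (z :* v :- y :* b) :+ z :* a :+ y :* b)
        := a :* z :+ (x :+ con (+ 1) :+ z :* v :+ y :* con (+ 1)))
        refl _ _ _ _ _ _)
      where
      i⊕1≡j⊕2 : i ⊕ + 1 ≡ j ⊕ + 2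
      i⊕1≡j⊕2 = ≡.sym (position o)
    row (suc (suc d)) {i} {j} o w = det₃-first-column _ _ _ _ _ _ _ _ _
      (tame i j (block-inArray o w))
      (diamond-at (offset↓ 1 o) w₂ (index-+1+1 i) ≡.refl)
      (row (suc d) (offset↓ 1 o) (within-≤ e (ℕₚ.n≤1+n _) w))
      (row d (offset↓ 2 o) w₂)
      where
      w₂ : Within e (2 ℕ.+ d)
      w₂ = within-≤ e (ℕₚ.m≤n+m (2 ℕ.+ d) 2) w

    -- The same induction, but with `i` fixed and `j` approached from `j ⊖ + 2` and `j ⊖ + 1`; the
    -- coefficient is always `E i i`.
    column : ∀ d {i j} → Offset i j (2 ℕ.+ d) → Within e (2 ℕ.+ d) → ColumnRelation E i j
    column zero {i} {j} o w = linear
      (at₂ E ≡.refl (≡.trans (offset-column o) ([i⊕k]⊖k≡i i (+ 2))) ⊞ zero-at (offset↓ 2 o)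
        ⊞ E i i ⊡ sym (one-at (offset↓ 1 o)))
      (solve 4 (λ x y z w →
        (x :+ y) :+ (z :+ con (+ 0) :+ z :* w) := z :* w :+ (x :+ y :+ z :* con (+ 1)))
        refl _ _ _ _)
    column (suc zero) {i} {j} o w = linear
      (one-at (offset↓ 2 o) ⊞ sym (diamond-at o′ w ≡.refl i⊕1≡j)
        ⊞ E (i ⊕ + 1) j ⊡ at₂ E (≡.refl {x = i}) i≡j′
        ⊞ E i j ⊡ sym (one-at (offset↓ 1 o′)))
      (solve 6 (λ x y z v a b →
        (x :+ y) :+ (con (+ 1) :+ (v :* z :- x :* b) :+ z :* a :+ x :* b)
        := a :* z :+ (y :+ con (+ 1) :+ z :* v :+ x :* con (+ 1)))
        refl _ _ _ _ _ _)
      where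
      j′ = j ⊖ + 1

      o′ : Offset i j′ 2
      o′ = offset← 1 o

      i⊕1≡j : j′ ⊕ + 1 ≡ j
      i⊕1≡j = [j⊖k]⊕k≡j j (+ 1)

      i≡j′ : j′ ≡ i
      i≡j′ = ≡.trans (offset-column o′) ([i⊕k]⊖k≡i i (+ 2))
    column (suc (suc d)) {i} {j} o w =
      ≡.subst (ColumnRelation E i) ([j⊖k]⊕k≡j j (+ 2)) (det₃-last-row _ _ _ _ _ _ _ _ _
        (tame i (j ⊖ + 2) (block-inArray o₂ w))
        (diamond-at (offset↓ 1 o₂) w₂ (index-+1+1 i) ≡.refl)
        (column d o₂ w₂)
        (column (suc d) (offset→ 1 o₂) (within-≤ e (ℕₚ.n≤1+n _) w)))
      where
      o₂ : Offset i (j ⊖ + 2) (2 ℕ.+ d)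
      o₂ = offset← 2 o

      w₂ : Within e (2 ℕ.+ d)
      w₂ = within-≤ e (ℕₚ.m≤n+m (2 ℕ.+ d) 2) w

  -- Extension of the relations across the row of zeros.

  module TameLattice (F : Frieze) (tame : Tame F)
                     (m : ℤ → ℤ → Carrier) (lattice : IsLattice F m) where

    open TameFrieze F tame
    open IsLattice lattice

    private
      e = extent F
      E = entry F

    extends-at : ∀ {i j d} → Offset i j d → Within e d → m i j ≈ E i j
    extends-at {i} {j} o w = extends i j (inArray e o w)

    zero-atᴸ : ∀ {i j} → Offset i j 0 → m i j ≈ 0#
    zero-atᴸ o = trans (extends-at o (within-≤ e ℕ.z≤n (within-3 e))) (zero-at o)

    one-atᴸ : ∀ {i j} → Offset i j 1 → m i j ≈ 1#
    one-atᴸ o = trans (extends-at o (within-≤ e (ℕ.s≤s ℕ.z≤n) (within-3 e))) (one-at o)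

    diagonalᴸ : ∀ k → m k k ≈ E k k
    diagonalᴸ k = extends-at {d = 2} (offset ≡.refl) (within-≤ e (ℕ.s≤s (ℕ.s≤s ℕ.z≤n)) (within-3 e))

    rowᴸ : ∀ {d i j} → Offset i j d → Within e (2 ℕ.+ d) → RowRelation m i j
    rowᴸ {d} {i} {j} o w = trans
      (+-cong (extends-at o (within-≤ e (ℕₚ.m≤n+m d 2) w)) (extends-at (offset→ 2 o) w))
      (trans (row d o w)
        (sym (*-cong (diagonalᴸ (j ⊕ + 2))
                     (extends-at (offset→ 1 o) (within-≤ e (ℕₚ.n≤1+n (1 ℕ.+ d)) w)))))

    columnᴸ : ∀ {d i j} → Offset i j (2 ℕ.+ d) → Within e (2 ℕ.+ d) → ColumnRelation m i j
    columnᴸ {d} {i} {j} o w = trans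
      (+-cong (extends-at o w) (extends-at (offset↓ 2 o) (within-≤ e (ℕₚ.m≤n+m d 2) w)))
      (trans (column d o w)
        (sym (*-cong (diagonalᴸ i)
                     (extends-at (offset↓ 1 o) (within-≤ e (ℕₚ.n≤1+n (1 ℕ.+ d)) w)))))

    module Antisymmetric (antisym : ∀ i j → m i j ≈ - m (j ⊕ + 2) (i ⊖ + 2)) where

      -- The three entries are -1, 0, 1, around the row of zeros.
      row-straddling : ∀ {i j} → j ⊕ + 3 ≡ i → RowRelation m i j
      row-straddling {j = j} ≡.refl = linear
        (trans (antisym (j ⊕ + 3) j) (-‿cong (one-atᴸ (offset (shift₋₁ j))))
          ⊞ one-atᴸ (offset (shift₁ j)) ⊞ m (j ⊕ + 2) (j ⊕ + 2) ⊡ sym (zero-atᴸ (offset (shift₀ j))))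
        (solve 4 (λ x y z a →
          (x :+ y) :+ (:- con (+ 1) :+ con (+ 1) :+ a :* z) := a :* z :+ (x :+ y :+ a :* con (+ 0)))
          refl _ _ _ _)
        where
        shift₋₁ : ∀ j → j ⊕ + 3 ⊖ + 2 ⊕ + 2 ≡ j ⊕ + 2 ⊕ + 1
        shift₋₁ = solve-∀
        shift₁ : ∀ j → j ⊕ + 2 ⊕ + 2 ≡ j ⊕ + 3 ⊕ + 1
        shift₁ = solve-∀
        shift₀ : ∀ j → j ⊕ + 1 ⊕ + 2 ≡ j ⊕ + 3 ⊕ + 0
        shift₀ = solve-∀

      -- All three entries reflect into the array, onto the column relation at `j ⊕ + 2`, whose
      -- coefficient is already the required one.
      row-reflected : ∀ {i j d} → j ⊕ + (4 ℕ.+ d) ≡ i → Within e (2 ℕ.+ d) → RowRelation m i j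
      row-reflected {i} {j} {d} i-eq w = linear
        (antisym i j ⊞ antisym i (j ⊕ + 2) ⊞ - 1# ⊡ columnᴸ o w
          ⊞ m (j ⊕ + 2) (j ⊕ + 2) ⊡ sym middle)
        (solve 7 (λ x y z k₀ k₁ k₂ a →
          (x :+ y) :+ (:- k₀ :+ :- k₂ :+ :- con (+ 1) :* (a :* k₁) :+ a :* z)
          := a :* z :+ (x :+ y :+ :- con (+ 1) :* (k₀ :+ k₂) :+ a :* :- k₁))
          refl _ _ _ _ _ _ _)
        where
        o : Offset (j ⊕ + 2) (i ⊖ + 2) (2 ℕ.+ d)
        o = offset (≡.trans ([j⊖k]⊕k≡j i (+ 2))
              (≡.trans (≡.sym i-eq) (≡.sym (ℤₚ.+-assoc j (+ 2) (+ (2 ℕ.+ d))))))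

        swap : ∀ j → j ⊕ + 1 ⊕ + 2 ≡ j ⊕ + 2 ⊕ + 1
        swap = solve-∀

        middle : m i (j ⊕ + 1) ≈ - m (j ⊕ + 2 ⊕ + 1) (i ⊖ + 2)
        middle = trans (antisym i (j ⊕ + 1)) (-‿cong (at₂ m (swap j) ≡.refl))

      row-below : ∀ d {i j} → j ⊕ + (3 ℕ.+ d) ≡ i → Within e (1 ℕ.+ d) → RowRelation m i j
      row-below zero    i-eq w = row-straddling i-eq
      row-below (suc d) i-eq w = row-reflected i-eq w

  -- Lattices of infinite friezes.

  module Infinite (F : Frieze) (tame : Tame F) (m : ℤ → ℤ → Carrier)
                  (lattice : IsLattice F m) (extent-eq : extent F ≡ infinite) where

    open TameLattice F tame m lattice
    open IsLattice lattice

    private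
      mirror : ∀ i j → j ⊖ i ℤ.< ⊝ + 2 → m i j ≈ - m (j ⊕ + 2) (i ⊖ + 2)
      mirror = ≡.subst (λ e → Mirrored e m) extent-eq mirrored

      within : ∀ d → Within (extent F) d
      within d = ≡.subst (λ e → Within e d) (≡.sym extent-eq) tt

      below : ∀ i j {d} → j ⊕ + 2 ⊖ i ≡ -[1+ d ] → j ⊖ i ℤ.< ⊝ + 2
      below i j {d} eq = ≡.subst (ℤ._< ⊝ + 2) (≡.trans (≡.cong (_⊖ + 2) (≡.sym eq)) (index i j))
        (ℤₚ.+-monoˡ-< (⊝ + 2) { -[1+ d ]} {+ 0} ℤ.-<+)
        where
        index : ∀ i j → j ⊕ + 2 ⊖ i ⊖ + 2 ≡ j ⊖ i
        index = solve-∀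

      j⊕2≡i⊕x : ∀ i j {x} → j ⊕ + 2 ⊖ i ≡ x → j ⊕ + 2 ≡ i ⊕ x
      j⊕2≡i⊕x i j ≡.refl = index i j
        where
        index : ∀ i j → j ⊕ + 2 ≡ i ⊕ (j ⊕ + 2 ⊖ i)
        index = solve-∀

    -- The mirror condition speaks only of positions below the row of zeros. The reflection is an
    -- involution of positions, which gives the positions above; on the row of zeros both sides
    -- vanish.
    antisym : ∀ i j → m i j ≈ - m (j ⊕ + 2) (i ⊖ + 2)
    antisym i j with j ⊕ + 2 ⊖ i in eq
    ... | -[1+ d ] = mirror i j (below i j eq)
    ... | + zero   = begin
        m i j                          ≈⟨ zero-atᴸ (offset (j⊕2≡i⊕x i j eq)) ⟩
        0#                             ≈⟨ -0#≈0# ⟨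
        - 0#                           ≈⟨ -‿cong (zero-atᴸ (offset o)) ⟨
        - m (j ⊕ + 2) (i ⊖ + 2)       ∎
      where
      open import Relation.Binary.Reasoning.Setoid setoid
      open import Algebra.Properties.Ring ring using (-0#≈0#)
      o : i ⊖ + 2 ⊕ + 2 ≡ j ⊕ + 2 ⊕ + 0
      o = ≡.trans ([j⊖k]⊕k≡j i (+ 2)) (≡.sym
        (≡.trans (ℤₚ.+-identityʳ (j ⊕ + 2)) (≡.trans (j⊕2≡i⊕x i j eq) (ℤₚ.+-identityʳ i))))
    ... | + suc d  = begin
        m i j
          ≈⟨ -‿involutive _ ⟨
        - (- (m i j))
          ≈⟨ -‿cong (-‿cong (at₂ m ([j⊖k]⊕k≡j i (+ 2)) ([i⊕k]⊖k≡i j (+ 2)))) ⟨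
        - (- m (i ⊖ + 2 ⊕ + 2) (j ⊕ + 2 ⊖ + 2))
          ≈⟨ -‿cong (mirror (j ⊕ + 2) (i ⊖ + 2) (below (j ⊕ + 2) (i ⊖ + 2) eq′)) ⟨
        - m (j ⊕ + 2) (i ⊖ + 2)  ∎
      where
      open import Relation.Binary.Reasoning.Setoid setoid
      open import Algebra.Properties.Ring ring using (-‿involutive)
      index : ∀ i j → i ⊖ + 2 ⊕ + 2 ⊖ (j ⊕ + 2) ≡ ⊝ (j ⊕ + 2 ⊖ i)
      index = solve-∀
      eq′ : i ⊖ + 2 ⊕ + 2 ⊖ (j ⊕ + 2) ≡ -[1+ d ]
      eq′ = ≡.trans (index i j) (≡.cong ⊝_ eq)

    open Antisymmetric antisym

    row-everywhere : ∀ i j → RowRelation m i j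
    row-everywhere i j with j ⊕ + 2 ⊖ i in eq
    ... | + d      = rowᴸ (offset (j⊕2≡i⊕x i j eq)) (within _)
    ... | -[1+ e ] = row-below e (below-index (j⊕2≡i⊕x i j eq)) (within _)
      where
      below-index : j ⊕ + 2 ≡ i ⊕ -[1+ e ] → j ⊕ + (3 ℕ.+ e) ≡ i
      below-index eq = ≡.trans (≡.sym (ℤₚ.+-assoc j (+ 2) (+ suc e)))
        (≡.trans (≡.cong (_⊕ + suc e) eq) ([j⊖k]⊕k≡j i (+ suc e)))

  -- Lattices of finite friezes: two mirrors and the translation they generate.

  module Finite (F : Frieze) (tame : Tame F) (m : ℤ → ℤ → Carrier) (lattice : IsLattice F m)
                {N : ℕ} {3≤N : 3 ℕ.≤ N} (extent-eq : extent F ≡ finite N 3≤N) where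

    open TameLattice F tame m lattice
    open IsLattice lattice

    private
      mirrors : Mirrored (finite N 3≤N) m
      mirrors = ≡.subst (λ e → Mirrored e m) extent-eq mirrored

      ends : LastRows (finite N 3≤N) (entry F)
      ends = ≡.subst (λ e → LastRows e (entry F)) extent-eq (lastRows F)

      within : ∀ {d} → d ℕ.≤ N → Within (extent F) d
      within {d} d≤N = ≡.subst (λ e → Within e d) (≡.sym extent-eq) d≤N

      zero-end : ∀ {i j d} → Offset i j d → d ≡ N → m i j ≈ 0#
      zero-end {i} o ≡.refl = trans (extends-at o (within ℕₚ.≤-refl))
        (trans (at₂ (entry F) ≡.refl (offset-column o)) (proj₂ (ends i)))

      one-end : ∀ {i j d} → Offset i j d → suc d ≡ N → m i j ≈ 1#
      one-end {i} {d = d} o ≡.refl = trans (extends-at o (within (ℕₚ.n≤1+n d)))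
        (trans (at₂ (entry F) ≡.refl (≡.trans (offset-column o) (index i (+ d)))) (proj₁ (ends i)))
        where
        index : ∀ i d → i ⊕ d ⊖ + 2 ≡ i ⊕ (+ 1 ⊕ d) ⊖ + 3
        index = solve-∀

    antisym : ∀ i j → m i j ≈ - m (j ⊕ + 2) (i ⊖ + 2)
    antisym i j = proj₁ (mirrors i j)

    open Antisymmetric antisym

    -- This is the composite of the two reflections, whose signs cancel. It raises the row number by
    -- `2N`.
    translate : ∀ i j → m i j ≈ m (i ⊖ + N) (j ⊕ + N)
    translate i j = begin
      m i j                                               ≈⟨ antisym i j ⟩
      - m (j ⊕ + 2) (i ⊖ + 2)                             ≈⟨ -‿cong (proj₂ (mirrors _ _)) ⟩
      - (- m (i ⊖ + 2 ⊖ + N ⊕ + 2) (j ⊕ + 2 ⊕ + N ⊖ + 2)) ≈⟨ -‿involutive _ ⟩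
      m (i ⊖ + 2 ⊖ + N ⊕ + 2) (j ⊕ + 2 ⊕ + N ⊖ + 2)       ≈⟨ at₂ m (index₁ i (+ N)) (index₂ j (+ N)) ⟩
      m (i ⊖ + N) (j ⊕ + N)                               ∎
      where
      open import Relation.Binary.Reasoning.Setoid setoid
      open import Algebra.Properties.Ring ring using (-‿involutive)
      index₁ : ∀ i n → i ⊖ + 2 ⊖ n ⊕ + 2 ≡ i ⊖ n
      index₁ = solve-∀
      index₂ : ∀ j n → j ⊕ + 2 ⊕ n ⊖ + 2 ≡ j ⊕ n
      index₂ = solve-∀

    -- The column relation at k and the row relation at k + 2, both ending on
    -- the closing rows of ones and zeros, identify m k k and m (k + N) (k + N)
    -- with the same entry.
    diagonal-periodic : ∀ k → m k k ≈ m (k ⊕ + N) (k ⊕ + N)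
    diagonal-periodic k with ℕₚ.m≤n⇒∃[o]m+o≡n (ℕₚ.≤-trans (ℕₚ.n≤1+n 2) 3≤N)
    ... | N′ , 2+N′≡N = trans
      (linear
        (sym (columnᴸ o w) ⊞ m k k ⊡ sym (one-end (offset↓ 1 o) 2+N′≡N)
          ⊞ rowᴸ o₂ w ⊞ m (j ⊕ + 2) (j ⊕ + 2) ⊡ one-end (offset→ 1 o₂) 2+N′≡N
          ⊞ zero-end o 2+N′≡N ⊞ sym (zero-end (offset→ 2 o₂) 2+N′≡N))
        (solve 7 (λ A A′ p q x y z →
          A :+ (x :+ y :+ A :* p :+ A′ :* q :+ A′ :* con (+ 1) :+ con (+ 0) :+ z)
          := A′ :+ (A :* p :+ A :* con (+ 1) :+ (y :+ z) :+ A′ :* q :+ x :+ con (+ 0)))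
          refl _ _ _ _ _ _ _))
      (at₂ m j⊕2≡k⊕N j⊕2≡k⊕N)
      where
      j = k ⊕ + N′

      o : Offset k j (2 ℕ.+ N′)
      o = offset (index k (+ N′))
        where
        index : ∀ k n → k ⊕ n ⊕ + 2 ≡ k ⊕ (+ 2 ⊕ n)
        index = solve-∀

      o₂ : Offset (k ⊕ + 2) j N′
      o₂ = offset↓ 2 o

      w : Within (extent F) (2 ℕ.+ N′)
      w = within (ℕₚ.≤-reflexive 2+N′≡N)

      j⊕2≡k⊕N : j ⊕ + 2 ≡ k ⊕ + N
      j⊕2≡k⊕N = ≡.trans (position o) (≡.cong (λ n → k ⊕ + n) 2+N′≡N)

    translate* : ∀ q i j → m i j ≈ m (i ⊖ q ⊛ + N) (j ⊕ q ⊛ + N)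
    translate* q i j = ℤ-induction (λ q → m i j ≈ m (i ⊖ q ⊛ + N) (j ⊕ q ⊛ + N))
      (at₂ m (≡.sym (ℤₚ.+-identityʳ i)) (≡.sym (ℤₚ.+-identityʳ j)))
      (λ q eq → trans eq (step q)) (λ q eq → trans eq (sym (step q))) q
      where
      index₁ : ∀ i q n → i ⊖ q ⊛ n ⊖ n ≡ i ⊖ (q ⊕ + 1) ⊛ n
      index₁ = solve-∀

      index₂ : ∀ j q n → j ⊕ q ⊛ n ⊕ n ≡ j ⊕ (q ⊕ + 1) ⊛ n
      index₂ = solve-∀

      step : ∀ q → m (i ⊖ q ⊛ + N) (j ⊕ q ⊛ + N)
                     ≈ m (i ⊖ (q ⊕ + 1) ⊛ + N) (j ⊕ (q ⊕ + 1) ⊛ + N)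
      step q = trans (translate _ _) (at₂ m (index₁ i q (+ N)) (index₂ j q (+ N)))

    diagonal-periodic* : ∀ q k → m k k ≈ m (k ⊕ q ⊛ + N) (k ⊕ q ⊛ + N)
    diagonal-periodic* q k = ℤ-induction (λ q → m k k ≈ m (k ⊕ q ⊛ + N) (k ⊕ q ⊛ + N))
      (at₂ m (≡.sym (ℤₚ.+-identityʳ k)) (≡.sym (ℤₚ.+-identityʳ k)))
      (λ q eq → trans eq (step q)) (λ q eq → trans eq (sym (step q))) q
      where
      index : ∀ j q n → j ⊕ q ⊛ n ⊕ n ≡ j ⊕ (q ⊕ + 1) ⊛ n
      index = solve-∀

      step : ∀ q → m (k ⊕ q ⊛ + N) (k ⊕ q ⊛ + N)
                     ≈ m (k ⊕ (q ⊕ + 1) ⊛ + N) (k ⊕ (q ⊕ + 1) ⊛ + N)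
      step q = trans (diagonal-periodic _) (at₂ m (index k q (+ N)) (index k q (+ N)))

    -- The translation moves the diagonal off itself, so the coefficient is transported by
    -- `diagonal-periodic*` instead.
    row-translate : ∀ q {i j} → RowRelation m (i ⊖ q ⊛ + N) (j ⊕ q ⊛ + N) → RowRelation m i j
    row-translate q {i} {j} relation = trans
      (+-cong (translate* q i j) (moved (+ 2)))
      (trans relation (sym (*-cong
        (trans (diagonal-periodic* q (j ⊕ + 2)) (at₂ m (swap j (+ 2) p) (swap j (+ 2) p)))
        (moved (+ 1)))))
      where
      p = q ⊛ + N

      swap : ∀ j k p → j ⊕ k ⊕ p ≡ j ⊕ p ⊕ k
      swap = solve-∀

      moved : ∀ k → m i (j ⊕ k) ≈ m (i ⊖ p) (j ⊕ p ⊕ k)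
      moved k = trans (translate* q i (j ⊕ k)) (at₂ m ≡.refl (swap j k p))

    -- The three entries are 1, 0, -1, around the closing zeros; the last one is outside the array
    -- and comes from the second mirror.
    row-end : ∀ {i j d} → Offset i j d → suc d ≡ N → RowRelation m i j
    row-end {i} {j} {d} o 1+d≡N = linear
      (one-end o 1+d≡N
        ⊞ trans (proj₂ (mirrors i (j ⊕ + 2))) (-‿cong (one-end (offset (index 1+d≡N)) 1+d≡N))
        ⊞ m (j ⊕ + 2) (j ⊕ + 2) ⊡ sym (zero-end (offset→ 1 o) 1+d≡N))
      (solve 4 (λ x y z a →
        (x :+ y) :+ (con (+ 1) :+ :- con (+ 1) :+ a :* z) := a :* z :+ (x :+ y :+ a :* con (+ 0)))
        refl _ _ _ _)
      where
      expanded : ∀ i d → i ⊕ (+ 1 ⊕ d) ⊖ + 2 ⊕ + 2 ≡ i ⊕ d ⊖ (+ 1 ⊕ d) ⊕ + 2 ⊕ d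
      expanded = solve-∀

      index : ∀ {N} → suc d ≡ N → i ⊕ + N ⊖ + 2 ⊕ + 2 ≡ j ⊕ + 2 ⊖ + N ⊕ + 2 ⊕ + d
      index ≡.refl = ≡.trans (expanded i (+ d))
        (≡.cong (λ k → k ⊖ + suc d ⊕ + 2 ⊕ + d) (≡.sym (position o)))

    row-within : ∀ {i j d} → Offset i j d → d ℕ.< N → RowRelation m i j
    row-within o d<N with ℕₚ.m≤n⇒m<n∨m≡n d<N
    ... | inj₁ 2+d≤N = rowᴸ o (within 2+d≤N)
    ... | inj₂ 1+d≡N = row-end o 1+d≡N

    -- The hypotheses say - N ≤ j + 2 - i < N: a full period of translate.
    row-window : ∀ {i j} r → r ℕ.< N ℕ.+ N → j ⊕ + 2 ⊕ + N ≡ i ⊕ + r → RowRelation m i j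
    row-window {i} {j} r r<2N eq with r ℕₚ.<? N
    -- The row number is `r - N`. Here it equals `-(1 + e)`, below the zeros; in the other case it
    -- is `d` with `d < N`.
    ... | yes r<N with ℕₚ.m≤n⇒∃[o]m+o≡n r<N
    ...   | e , 1+r+e≡N = row-below e (index 1+r+e≡N eq)
              (within (≡.subst (1 ℕ.+ e ℕ.≤_) 1+r+e≡N (ℕ.s≤s (ℕₚ.m≤n+m e r))))
      where
      expanded : ∀ j r e → j ⊕ (+ 3 ⊕ e) ≡ j ⊕ + 2 ⊕ (+ 1 ⊕ r ⊕ e) ⊖ r
      expanded = solve-∀

      index : ∀ {N} → suc r ℕ.+ e ≡ N → j ⊕ + 2 ⊕ + N ≡ i ⊕ + r → j ⊕ + (3 ℕ.+ e) ≡ i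
      index ≡.refl eq = ≡.trans (expanded j (+ r) (+ e))
        (≡.trans (≡.cong (_⊖ + r) eq) ([i⊕k]⊖k≡i i (+ r)))
    row-window {i} {j} r r<2N eq | no r≮N with ℕₚ.m≤n⇒∃[o]m+o≡n (ℕₚ.≮⇒≥ r≮N)
    ... | d , ≡.refl = row-within (offset (index eq)) (ℕₚ.+-cancelˡ-< N d N r<2N)
      where
      expanded : ∀ i n d → i ⊕ (n ⊕ d) ⊖ n ≡ i ⊕ d
      expanded = solve-∀

      index : j ⊕ + 2 ⊕ + N ≡ i ⊕ + (N ℕ.+ d) → j ⊕ + 2 ≡ i ⊕ + d
      index eq = ≡.trans (≡.sym ([i⊕k]⊖k≡i (j ⊕ + 2) (+ N)))
        (≡.trans (≡.cong (_⊖ + N) eq) (expanded i (+ N) (+ d)))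

    row-everywhere : ∀ i j → RowRelation m i j
    row-everywhere i j = row-translate (⊝ q) (row-window r (n%ℕd<d δ (N ℕ.+ N)) index)
      where
      instance
        N+N≢0 : ℕ.NonZero (N ℕ.+ N)
        N+N≢0 = ℕ.>-nonZero (ℕₚ.≤-trans (ℕ.s≤s ℕ.z≤n) (ℕₚ.≤-trans 3≤N (ℕₚ.m≤m+n N N)))

      -- This is the row number raised by `N`. Translating `q` times lowers it by `2qN`, leaving the
      -- remainder `r` that `row-window` expects.
      δ = j ⊕ + 2 ⊕ + N ⊖ i
      q = δ /ℕ (N ℕ.+ N)
      r = δ %ℕ (N ℕ.+ N)

      lhs : ∀ i j n q → j ⊕ ⊝ q ⊛ n ⊕ + 2 ⊕ n ≡ (j ⊕ + 2 ⊕ n ⊖ i) ⊕ i ⊖ q ⊛ n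
      lhs = solve-∀

      rhs : ∀ i n q r → (r ⊕ q ⊛ (n ⊕ n)) ⊕ i ⊖ q ⊛ n ≡ i ⊖ ⊝ q ⊛ n ⊕ r
      rhs = solve-∀

      index : j ⊕ ⊝ q ⊛ + N ⊕ + 2 ⊕ + N ≡ i ⊖ ⊝ q ⊛ + N ⊕ + r
      index = ≡.trans (lhs i j (+ N) q)
        (≡.trans (≡.cong (λ x → x ⊕ i ⊖ q ⊛ + N) (a≡a%ℕn+[a/ℕn]*n δ (N ℕ.+ N)))
          (rhs i (+ N) q (+ r)))

  -- The period recurrence for the lattice of a tame frieze.

  module _ (F : Frieze) (tame : Tame F) (m : ℤ → ℤ → Carrier) (lattice : IsLattice F m) where

    open TameLattice F tame m lattice

    lattice-antisym : ∀ i j → m i j ≈ - m (j ⊕ + 2) (i ⊖ + 2)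
    lattice-antisym = by-extent (extent F) ≡.refl
      where
      -- The extent becomes a variable with an equation, so that matching on it leaves `F` and
      -- `lattice` intact.
      by-extent : ∀ e → extent F ≡ e → ∀ i j → m i j ≈ - m (j ⊕ + 2) (i ⊖ + 2)
      by-extent infinite     = Infinite.antisym F tame m lattice
      by-extent (finite N _) = Finite.antisym F tame m lattice

    lattice-row : ∀ i j → RowRelation m i j
    lattice-row = by-extent (extent F) ≡.refl
      where
      by-extent : ∀ e → extent F ≡ e → ∀ i j → RowRelation m i j
      by-extent infinite     = Infinite.row-everywhere F tame m lattice
      by-extent (finite N _) = Finite.row-everywhere F tame m lattice

    period-recurrence : ∀ n → Periodic n F →
      let s = m (+ 1) (+ n) - m (+ 2) (+ n ⊖ + 1) in
      ∀ i j → (m i (j ⊕ + (2 ℕ.* n)) ≈ s * m i (j ⊕ + n) - m i j)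
              × (m (i ⊖ + (2 ℕ.* n)) j ≈ s * m (i ⊖ + n) j - m i j)
    period-recurrence n periodic i j = along-row i j , (begin
      m (i ⊖ + (2 ℕ.* n)) j
        ≈⟨ lattice-antisym _ _ ⟩
      - m j₂ i₂
        -- In `along-row` both outer terms, brought to one side, have coefficient 1, so it can
        -- equally be solved for its earliest column.
        ≈⟨ linear (sym (along-row j₂ i₂))
             (solve 4 (λ s x y z →
               :- z :+ x := (s :* :- y :- :- x) :+ (s :* y :- z)) refl _ _ _ _) ⟩
      s * - m j₂ (i₂ ⊕ + n) - - m j₂ (i₂ ⊕ + (2 ℕ.* n))
        ≈⟨ +-cong (*-congˡ (reflect (index₁ i (+ n)))) (-‿cong (reflect (index₂ i (+ (2 ℕ.* n))))) ⟩
      s * m (i ⊖ + n) j - m i j  ∎)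
      where
      open import Relation.Binary.Reasoning.Setoid setoid

      s  = m (+ 1) (+ n) - m (+ 2) (+ n ⊖ + 1)
      j₂ = j ⊕ + 2
      i₂ = i ⊖ + (2 ℕ.* n) ⊖ + 2

      reflect : ∀ {k l} → l ≡ k ⊖ + 2 → - m j₂ l ≈ m k j
      reflect {k} eq = trans (-‿cong (at₂ m ≡.refl eq)) (sym (lattice-antisym k j))

      -- The nested sum is what `+ (2 ℕ.* n)` computes to.
      index₁ : ∀ i n → i ⊖ (n ⊕ (n ⊕ + 0)) ⊖ + 2 ⊕ n ≡ i ⊖ n ⊖ + 2
      index₁ = solve-∀

      index₂ : ∀ i n → i ⊖ n ⊖ + 2 ⊕ n ≡ i ⊖ + 2
      index₂ = solve-∀

      coefficient : ℤ → Carrier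
      coefficient j = m (j ⊕ + 2) (j ⊕ + 2)

      coefficient-periodic : ∀ j → coefficient (j ⊕ + n) ≈ coefficient j
      coefficient-periodic j = begin
        m (j ⊕ + n ⊕ + 2) (j ⊕ + n ⊕ + 2)     ≈⟨ at₂ m (swap j (+ n)) (swap j (+ n)) ⟩
        m (k ⊕ + n) (k ⊕ + n)                 ≈⟨ diagonalᴸ (k ⊕ + n) ⟩
        entry F (k ⊕ + n) (k ⊕ + n)           ≈⟨ periodic k k diagonal-inArray ⟩
        entry F k k                           ≈⟨ diagonalᴸ k ⟨
        m k k                                 ∎
        where
        k = j ⊕ + 2

        diagonal-inArray : InArray (extent F) k k
        diagonal-inArray = inArray (extent F) {d = 2} (offset ≡.refl)
          (within-≤ (extent F) (ℕₚ.n≤1+n 2) (within-3 (extent F)))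

        swap : ∀ j n → j ⊕ n ⊕ + 2 ≡ j ⊕ + 2 ⊕ n
        swap = solve-∀

      along-row : ∀ i j → m i (j ⊕ + (2 ℕ.* n)) ≈ s * m i (j ⊕ + n) - m i j
      along-row i j = trans (at₂ m ≡.refl (index j (+ n)))
        (monodromy (lattice-row (+ 1)) (lattice-row (+ 2))
          -- At the columns -1 and 0, row 1 has the entries 0, 1 and row 2 has -1, 0, the -1 being a
          -- mirrored one. With these rows as basis the trace is literally `s`.
          (zero-atᴸ (offset ≡.refl)) (one-atᴸ (offset ≡.refl))
          (trans (lattice-antisym (+ 2) -[1+ 0 ]) (-‿cong (one-atᴸ (offset ≡.refl))))
          (zero-atᴸ (offset ≡.refl))
          (+ n) coefficient-periodic (lattice-row i) j)
        where
        index : ∀ j n → j ⊕ (n ⊕ (n ⊕ + 0)) ≡ j ⊕ n ⊕ n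
        index = solve-∀

-- Specialisation to friezes of real numbers.

open import Defs
open import Data.Integer.Base using () renaming (_+_ to _⊕_; _-_ to _⊖_)

theorem2p5 : (n : ℕ) → 1 ℕ.≤ n →
    (F : Frieze) → Tame F → Periodic n F →
    (q : Vector ℝ n) → IsQuidditySequence F q →
    (m : ℤ → ℤ → ℝ) → IsLattice F m →
    let s = m (+ 1) (+ n) - m (+ 2) (+ n ⊖ + 1) in
    ∀ (i j : ℤ) →
    (m i (j ⊕ + (2 ℕ.* n)) ≈ s * m i (j ⊕ + n) - m i j)
    × (m (i ⊖ + (2 ℕ.* n)) j ≈ s * m (i ⊖ + n) j - m i j)
theorem2p5 n _ F tame periodic _ _ m lattice =
  Lattices.period-recurrence ℝ-commutativeRing F tame m lattice n periodic
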